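{- Let $T_n(y)$ and $U_n(y)$ denote the Chebyshev polynomials of the first and second kind, extended to all integer indices. For all $x,y,r\in\mathbb{C}$ and all integers $c,n$ with $n\ge c$ (and $x\neq0$ if $c<0$), \[ \sum_{k=c}^n r^{n-k}x^k\big(rT_k(y)+(xy-r)U_k(y)\big)=x^{n+1}y\,U_n(y)-r^{n-c+1}x^c y\,U_{c-1}(y) \] and \[ \sum_{k=c}^n r^{n-k}x^k\big((y^2-1)r\,U_{k-2}(y)+(xy-r)T_k(y)\big)=x^{n+1}y\,T_n(y)-r^{n-c+1}x^c y\,T_{c-1}(y). \]
   Context: The Chebyshev polynomials are defined by $T_0(y)=1$, $T_1(y)=y$, $T_n(y)=2yT_{n-1}(y)-T_{n-2}(y)$ and $U_0(y)=1$, $U_1(y)=2y$, $U_n(y)=2yU_{n-1}(y)-U_{n-2}(y)$ for $n\ge 2$; they are extended to negative indices so that these recurrences hold for all integers $n$ (equivalently $T_{ -n}(y)=T_n(y)$ and $U_{ -n}(y)=2yU_{ -(n-1)}(y)-U_{ -(n-2)}(y)$, so $U_{ -1}(y)=0$). -}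

module Defs where

open import Algebra.Bundles using (CommutativeRing)
open import Algebra.Structures using (IsCommutativeRing)
open import Data.Fin.Base using (toℕ)
open import Data.Integer.Base as ℤ using (ℤ; -[1+_]; 0ℤ)
import Data.Integer.Properties as ℤ
open import Data.Nat.Base as ℕ using (ℕ; zero; suc)
import Data.Nat.Properties as ℕ
open import Data.Product.Base using (∃-syntax; _×_; _,_; proj₁; proj₂)
open import Data.Rational.Base
open import Data.Rational.Properties
open import Data.Rational.Solver using (module +-*-Solver)
open import Data.Sum.Base using (_⊎_; inj₁; inj₂)
open import Level using (0ℓ)
open import Relation.Binary.PropositionalEquality
open import Relation.Nullary using (yes; no; contradiction)

open +-*-Solver using (solve; _:+_; _:*_; _:-_; :-_; _:=_; con)

private
  half : ∀ {ε} → 0ℚ < ε → ∃[ δ ] 0ℚ < δ × δ + δ ≡ ε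
  half {ε} 0<ε = ½ * ε ,
    subst (_< ½ * ε) (*-zeroʳ ½) (*-monoʳ-<-pos ½ 0<ε) ,
    trans (sym (*-distribʳ-+ ε ½ ½)) (*-identityˡ ε)

  0<* : ∀ {p q} → 0ℚ < p → 0ℚ < q → 0ℚ < p * q
  0<* {p} {q} 0<p 0<q =
    subst (_< p * q) (*-zeroʳ p) (*-monoʳ-<-pos p {{positive 0<p}} 0<q)

  *-mono-≤ : ∀ {p q r s} → 0ℚ ≤ q → 0ℚ ≤ r → p ≤ q → r ≤ s → p * r ≤ q * s
  *-mono-≤ {p} {q} {r} 0≤q 0≤r p≤q r≤s = ≤-trans
    (*-monoʳ-≤-nonNeg r {{nonNegative 0≤r}} p≤q)
    (*-monoˡ-≤-nonNeg q {{nonNegative 0≤q}} r≤s)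

  shrink : ∀ {ε B} → 0ℚ < ε → 0ℚ < B → ∃[ δ ] 0ℚ < δ × δ * B ≡ ε
  shrink {ε} {B} 0<ε 0<B = ε * 1/ B ,
    0<* 0<ε (positive⁻¹ (1/ B) {{1/pos⇒pos B}}) ,
    trans (*-assoc ε (1/ B) B) (trans (cong (ε *_) (*-inverseˡ B)) (*-identityʳ ε))
    where instance
      B-pos : Positive B
      B-pos = positive 0<B
      B≢0 : NonZero B
      B≢0 = pos⇒nonZero B

-- The value at 0 is irrelevant: it is only used for sequences bounded
-- away from 0.
recip : ℚ → ℚ
recip q with q ≟ 0ℚ
... | yes _   = 0ℚ
... | no q≢0 = (1/ q) {{≢-nonZero q≢0}}

private
  recip-inverseʳ : ∀ {δ} q → 0ℚ < δ → δ ≤ ∣ q ∣ → q * recip q ≡ 1ℚ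
  recip-inverseʳ q 0<δ δ≤∣q∣ with q ≟ 0ℚ
  ... | yes refl = contradiction (<-≤-trans 0<δ δ≤∣q∣) (<-irrefl refl)
  ... | no q≢0  = *-inverseʳ q {{≢-nonZero q≢0}}

  ∣recip∣≤ : ∀ {δ} q → 0ℚ < δ → δ ≤ ∣ q ∣ → ∣ recip q ∣ ≤ recip δ
  ∣recip∣≤ {δ} q 0<δ δ≤∣q∣ = *-cancelˡ-≤-pos δ {{positive 0<δ}} (begin
    δ * ∣ recip q ∣      ≤⟨ *-monoʳ-≤-nonNeg ∣ recip q ∣ {{∣-∣-nonNeg (recip q)}} δ≤∣q∣ ⟩
    ∣ q ∣ * ∣ recip q ∣  ≡⟨ ∣p*q∣≡∣p∣*∣q∣ q (recip q) ⟨
    ∣ q * recip q ∣      ≡⟨ cong ∣_∣ (recip-inverseʳ q 0<δ δ≤∣q∣) ⟩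
    1ℚ                   ≡⟨ recip-inverseʳ δ 0<δ (≤-reflexive (sym (0≤p⇒∣p∣≡p (<⇒≤ 0<δ)))) ⟨
    δ * recip δ          ∎)
    where open ≤-Reasoning

  0<recip : ∀ {δ} → 0ℚ < δ → 0ℚ < recip δ
  0<recip {δ} 0<δ = *-cancelˡ-<-nonNeg δ {{nonNegative (<⇒≤ 0<δ)}} (begin-strict
    δ * 0ℚ       ≡⟨ *-zeroʳ δ ⟩
    0ℚ           <⟨ positive⁻¹ 1ℚ ⟩
    1ℚ           ≡⟨ recip-inverseʳ δ 0<δ (≤-reflexive (sym (0≤p⇒∣p∣≡p (<⇒≤ 0<δ)))) ⟨
    δ * recip δ  ∎)
    where open ≤-Reasoning

-- Real numbers are Cauchy sequences of rationals, up to null sequences.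
-- `Close s s` says that s is a Cauchy sequence; for Cauchy sequences s
-- and t, `Close s t` is equivalent to s n - t n → 0.
record Close (s t : ℕ → ℚ) : Set where
  constructor mkClose
  field
    bound : ∀ ε → 0ℚ < ε →
      ∃[ N ] ∀ m n → N ℕ.≤ m → N ℕ.≤ n → ∣ s m - t n ∣ < ε

open Close

record ℝ : Set where
  constructor mkℝ
  field
    seq    : ℕ → ℚ
    cauchy : Close seq seq

open ℝ public

infix 4 _≈ℝ_

_≈ℝ_ : ℝ → ℝ → Set
x ≈ℝ y = Close (seq x) (seq y)

private
  ∣-∣-swap : ∀ p q → ∣ p - q ∣ ≡ ∣ q - p ∣
  ∣-∣-swap p q = trans (sym (∣-p∣≡∣p∣ (p - q)))
    (cong ∣_∣ (solve 2 (λ p q → :- (p :- q) := q :- p) refl p q))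

  close-sym : ∀ {s t} → Close s t → Close t s
  close-sym {s} {t} c = mkClose λ ε 0<ε → let N , h = bound c ε 0<ε in
    N , λ m n N≤m N≤n → subst (_< ε) (∣-∣-swap (s n) (t m)) (h n m N≤n N≤m)

  <-half : ∀ {p δ ε} q r → δ + δ ≡ ε → p ≡ q + r → ∣ q ∣ < δ → ∣ r ∣ < δ → ∣ p ∣ < ε
  <-half q r refl refl q<δ r<δ =
    ≤-<-trans (∣p+q∣≤∣p∣+∣q∣ q r) (+-mono-< q<δ r<δ)

  close-trans : ∀ {s t u} → Close s t → Close t u → Close s u
  close-trans {s} {t} {u} c d = mkClose λ ε 0<ε →
    let δ , 0<δ , δ+δ≡ε = half 0<ε
        M , f = bound c δ 0<δ
        N , g = bound d δ 0<δ
    in M ℕ.⊔ N , λ m n M⊔N≤m M⊔N≤n →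
      <-half (s m - t n) (t n - u n) δ+δ≡ε
        (solve 3 (λ a b c → a :- c := (a :- b) :+ (b :- c)) refl (s m) (t n) (u n))
        (f m n (ℕ.m⊔n≤o⇒m≤o M N M⊔N≤m) (ℕ.m⊔n≤o⇒m≤o M N M⊔N≤n))
        (g n n (ℕ.m⊔n≤o⇒n≤o M N M⊔N≤n) (ℕ.m⊔n≤o⇒n≤o M N M⊔N≤n))

  close-+ : ∀ {s t s′ t′} → Close s t → Close s′ t′ →
            Close (λ n → s n + s′ n) (λ n → t n + t′ n)
  close-+ {s} {t} {s′} {t′} c d = mkClose λ ε 0<ε →
    let δ , 0<δ , δ+δ≡ε = half 0<ε
        M , f = bound c δ 0<δ
        N , g = bound d δ 0<δ
    in M ℕ.⊔ N , λ m n M⊔N≤m M⊔N≤n →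
      <-half (s m - t n) (s′ m - t′ n) δ+δ≡ε
        (solve 4 (λ a b a′ b′ → (a :+ a′) :- (b :+ b′) := (a :- b) :+ (a′ :- b′))
          refl (s m) (t n) (s′ m) (t′ n))
        (f m n (ℕ.m⊔n≤o⇒m≤o M N M⊔N≤m) (ℕ.m⊔n≤o⇒m≤o M N M⊔N≤n))
        (g m n (ℕ.m⊔n≤o⇒n≤o M N M⊔N≤m) (ℕ.m⊔n≤o⇒n≤o M N M⊔N≤n))

  close-neg : ∀ {s t} → Close s t → Close (λ n → - s n) (λ n → - t n)
  close-neg {s} {t} c = mkClose λ ε 0<ε → let N , f = bound c ε 0<ε in N , λ m n N≤m N≤n →
    subst (_< ε)
      (trans (∣-∣-swap (s m) (t n))
        (cong ∣_∣ (solve 2 (λ a b → b :- a := (:- a) :- (:- b)) refl (s m) (t n))))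
      (f m n N≤m N≤n)

  Bounded : (ℕ → ℚ) → Set
  Bounded s = ∃[ B ] ∃[ N ] 0ℚ < B × (∀ n → N ℕ.≤ n → ∣ s n ∣ ≤ B)

  close⇒bounded : ∀ {s t} → Close s t → Bounded s
  close⇒bounded {s} {t} c = let N , f = bound c 1ℚ (positive⁻¹ 1ℚ) in
    1ℚ + ∣ t N ∣ , N ,
    +-mono-<-≤ (positive⁻¹ 1ℚ) (0≤∣p∣ (t N)) ,
    λ n N≤n → begin
      ∣ s n ∣                    ≡⟨ cong ∣_∣ (solve 2 (λ a b → a := (a :- b) :+ b) refl (s n) (t N)) ⟩
      ∣ (s n - t N) + t N ∣      ≤⟨ ∣p+q∣≤∣p∣+∣q∣ (s n - t N) (t N) ⟩
      ∣ s n - t N ∣ + ∣ t N ∣    ≤⟨ +-monoˡ-≤ ∣ t N ∣ (<⇒≤ (f n N N≤n ℕ.≤-refl)) ⟩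
      1ℚ + ∣ t N ∣               ∎
    where open ≤-Reasoning

  <-scale : ∀ {δ B ε} p q → 0ℚ < B → δ * B ≡ ε → ∣ p ∣ < δ → ∣ q ∣ ≤ B → ∣ p * q ∣ < ε
  <-scale {δ} {B} p q 0<B refl p<δ q≤B = begin-strict
    ∣ p * q ∣      ≡⟨ ∣p*q∣≡∣p∣*∣q∣ p q ⟩
    ∣ p ∣ * ∣ q ∣  ≤⟨ *-monoˡ-≤-nonNeg ∣ p ∣ {{∣-∣-nonNeg p}} q≤B ⟩
    ∣ p ∣ * B      <⟨ *-monoˡ-<-pos B {{positive 0<B}} p<δ ⟩
    δ * B          ∎
    where open ≤-Reasoning

  close-* : ∀ {s t s′ t′} → Close s t → Close s′ t′ →
            Close (λ n → s n * s′ n) (λ n → t n * t′ n)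
  close-* {s} {t} {s′} {t′} c d = mkClose λ ε 0<ε →
    let δ , 0<δ , δ+δ≡ε = half 0<ε
        B , K , 0<B , bd-s′ = close⇒bounded d
        C , L , 0<C , bd-t = close⇒bounded (close-sym c)
        β , 0<β , βB≡δ = shrink 0<δ 0<B
        γ , 0<γ , γC≡δ = shrink 0<δ 0<C
        M , f = bound c β 0<β
        N , g = bound d γ 0<γ
    in (K ℕ.⊔ L) ℕ.⊔ (M ℕ.⊔ N) , λ m n le-m le-n →
      let KL≤m = ℕ.m⊔n≤o⇒m≤o (K ℕ.⊔ L) (M ℕ.⊔ N) le-m
          KL≤n = ℕ.m⊔n≤o⇒m≤o (K ℕ.⊔ L) (M ℕ.⊔ N) le-n
          MN≤m = ℕ.m⊔n≤o⇒n≤o (K ℕ.⊔ L) (M ℕ.⊔ N) le-m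
          MN≤n = ℕ.m⊔n≤o⇒n≤o (K ℕ.⊔ L) (M ℕ.⊔ N) le-n
      in <-half ((s m - t n) * s′ m) ((s′ m - t′ n) * t n) δ+δ≡ε
        (solve 4 (λ a b a′ b′ → a :* a′ :- b :* b′ := (a :- b) :* a′ :+ (a′ :- b′) :* b)
          refl (s m) (t n) (s′ m) (t′ n))
        (<-scale (s m - t n) (s′ m) 0<B βB≡δ
          (f m n (ℕ.m⊔n≤o⇒m≤o M N MN≤m) (ℕ.m⊔n≤o⇒m≤o M N MN≤n))
          (bd-s′ m (ℕ.m⊔n≤o⇒m≤o K L KL≤m)))
        (<-scale (s′ m - t′ n) (t n) 0<C γC≡δ
          (g m n (ℕ.m⊔n≤o⇒n≤o M N MN≤m) (ℕ.m⊔n≤o⇒n≤o M N MN≤n))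
          (bd-t n (ℕ.m⊔n≤o⇒n≤o K L KL≤n)))

  eventually≡⇒close : ∀ {s t} N → (∀ n → N ℕ.≤ n → s n ≡ t n) → Close t t → Close s t
  eventually≡⇒close {s} {t} N s≡t c = mkClose λ ε 0<ε → let M , f = bound c ε 0<ε in
    M ℕ.⊔ N , λ m n M⊔N≤m M⊔N≤n →
      subst (λ p → ∣ p - t n ∣ < ε) (sym (s≡t m (ℕ.m⊔n≤o⇒n≤o M N M⊔N≤m)))
        (f m n (ℕ.m⊔n≤o⇒m≤o M N M⊔N≤m) (ℕ.m⊔n≤o⇒m≤o M N M⊔N≤n))

  ≗⇒≈ℝ : ∀ {x y} → (∀ n → seq x n ≡ seq y n) → x ≈ℝ y
  ≗⇒≈ℝ {x} {y} x≗y = eventually≡⇒close 0 (λ n _ → x≗y n) (cauchy y)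

fromℚ : ℚ → ℝ
fromℚ q = mkℝ (λ _ → q) (mkClose λ ε 0<ε →
  0 , λ _ _ _ _ → subst (_< ε) (sym (cong ∣_∣ (+-inverseʳ q))) 0<ε)

infixl 6 _+ℝ_
infixl 7 _*ℝ_
infix  8 -ℝ_

_+ℝ_ _*ℝ_ : ℝ → ℝ → ℝ
x +ℝ y = mkℝ (λ n → seq x n + seq y n) (close-+ (cauchy x) (cauchy y))
x *ℝ y = mkℝ (λ n → seq x n * seq y n) (close-* (cauchy x) (cauchy y))

-ℝ_ : ℝ → ℝ
-ℝ x = mkℝ (λ n → - seq x n) (close-neg (cauchy x))

-- Being nonzero, in the positive sense of being apart from 0: eventually
-- bounded away from 0.
infix 4 _#0ℝ _#0

_#0ℝ : ℝ → Set
x #0ℝ = ∃[ δ ] ∃[ N ] 0ℚ < δ × (∀ n → N ℕ.≤ n → δ ≤ ∣ seq x n ∣)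

recipℝ : (x : ℝ) → x #0ℝ → ℝ
recipℝ x (δ , N , 0<δ , away) = mkℝ (λ n → recip (seq x n)) close
  where
  s r : ℕ → ℚ
  s = seq x
  r n = recip (s n)

  difference : ∀ m n → N ℕ.≤ m → N ℕ.≤ n → r m - r n ≡ (s n - s m) * (r m * r n)
  difference m n N≤m N≤n = begin
    r m - r n
      ≡⟨ cong₂ _-_ (*-identityˡ (r m)) (*-identityˡ (r n)) ⟨
    1ℚ * r m - 1ℚ * r n
      ≡⟨ cong₂ (λ p q → p * r m - q * r n)
               (recip-inverseʳ (s n) 0<δ (away n N≤n))
               (recip-inverseʳ (s m) 0<δ (away m N≤m)) ⟨
    (s n * r n) * r m - (s m * r m) * r n
      ≡⟨ solve 4 (λ a b a′ b′ → (b :* b′) :* a′ :- (a :* a′) :* b′ := (b :- a) :* (a′ :* b′))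
               refl (s m) (s n) (r m) (r n) ⟩
    (s n - s m) * (r m * r n)
      ∎
    where open ≡-Reasoning

  close : Close r r
  close = mkClose λ ε 0<ε →
    let 0<B = 0<* (0<recip 0<δ) (0<recip 0<δ)
        β , 0<β , βB≡ε = shrink 0<ε 0<B
        M , f = bound (cauchy x) β 0<β
    in M ℕ.⊔ N , λ m n M⊔N≤m M⊔N≤n →
      let N≤m = ℕ.m⊔n≤o⇒n≤o M N M⊔N≤m
          N≤n = ℕ.m⊔n≤o⇒n≤o M N M⊔N≤n
      in subst (λ p → ∣ p ∣ < ε) (sym (difference m n N≤m N≤n))
        (<-scale (s n - s m) (r m * r n) 0<B βB≡ε
          (f n m (ℕ.m⊔n≤o⇒m≤o M N M⊔N≤n) (ℕ.m⊔n≤o⇒m≤o M N M⊔N≤m))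
          (subst (_≤ recip δ * recip δ) (sym (∣p*q∣≡∣p∣*∣q∣ (r m) (r n)))
            (*-mono-≤ (<⇒≤ (0<recip 0<δ)) (0≤∣p∣ (r n))
              (∣recip∣≤ (s m) 0<δ (away m N≤m))
              (∣recip∣≤ (s n) 0<δ (away n N≤n)))))

record ℂ : Set where
  constructor _+i_
  field
    re im : ℝ

open ℂ public

infix 4 _≈ℂ_

record _≈ℂ_ (z w : ℂ) : Set where
  constructor mk≈
  field
    re-≈ : re z ≈ℝ re w
    im-≈ : im z ≈ℝ im w

_#0 : ℂ → Set
z #0 = re z #0ℝ ⊎ im z #0ℝ

infixl 6 _+ℂ_
infixl 7 _*ℂ_
infix  8 -ℂ_

_+ℂ_ _*ℂ_ : ℂ → ℂ → ℂ
z +ℂ w = (re z +ℝ re w) +i (im z +ℝ im w)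
z *ℂ w = (re z *ℝ re w +ℝ -ℝ (im z *ℝ im w)) +i (re z *ℝ im w +ℝ im z *ℝ re w)

-ℂ_ : ℂ → ℂ
-ℂ z = (-ℝ re z) +i (-ℝ im z)

0ℂ 1ℂ : ℂ
0ℂ = fromℚ 0ℚ +i fromℚ 0ℚ
1ℂ = fromℚ 1ℚ +i fromℚ 0ℚ

private
  ≗⇒≈ℂ : ∀ {z w} → (∀ n → seq (re z) n ≡ seq (re w) n) →
         (∀ n → seq (im z) n ≡ seq (im w) n) → z ≈ℂ w
  ≗⇒≈ℂ {z} {w} p q = mk≈ (≗⇒≈ℝ {re z} {re w} p) (≗⇒≈ℝ {im z} {im w} q)

  isCommutativeRing : IsCommutativeRing _≈ℂ_ _+ℂ_ _*ℂ_ -ℂ_ 0ℂ 1ℂ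
  isCommutativeRing = record
    { isRing = record
      { +-isAbelianGroup = record
        { isGroup = record
          { isMonoid = record
            { isSemigroup = record
              { isMagma = record
                { isEquivalence = record
                  { refl  = λ {z} → mk≈ (cauchy (re z)) (cauchy (im z))
                  ; sym   = λ (mk≈ p q) → mk≈ (close-sym p) (close-sym q)
                  ; trans = λ (mk≈ p q) (mk≈ p′ q′) → mk≈ (close-trans p p′) (close-trans q q′)
                  }
                ; ∙-cong = λ (mk≈ p q) (mk≈ p′ q′) → mk≈ (close-+ p p′) (close-+ q q′)
                }
              ; assoc = λ u v w → ≗⇒≈ℂ
                  (λ n → +-assoc (seq (re u) n) (seq (re v) n) (seq (re w) n))
                  (λ n → +-assoc (seq (im u) n) (seq (im v) n) (seq (im w) n))
              }
            ; identity =
                (λ z → ≗⇒≈ℂ (λ n → +-identityˡ (seq (re z) n)) (λ n → +-identityˡ (seq (im z) n))) ,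
                (λ z → ≗⇒≈ℂ (λ n → +-identityʳ (seq (re z) n)) (λ n → +-identityʳ (seq (im z) n)))
            }
          ; inverse =
              (λ z → ≗⇒≈ℂ (λ n → +-inverseˡ (seq (re z) n)) (λ n → +-inverseˡ (seq (im z) n))) ,
              (λ z → ≗⇒≈ℂ (λ n → +-inverseʳ (seq (re z) n)) (λ n → +-inverseʳ (seq (im z) n)))
          ; ⁻¹-cong = λ (mk≈ p q) → mk≈ (close-neg p) (close-neg q)
          }
        ; comm = λ z w → ≗⇒≈ℂ
            (λ n → +-comm (seq (re z) n) (seq (re w) n))
            (λ n → +-comm (seq (im z) n) (seq (im w) n))
        }
      ; *-cong = λ (mk≈ p q) (mk≈ p′ q′) → mk≈
          (close-+ (close-* p p′) (close-neg (close-* q q′)))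
          (close-+ (close-* p q′) (close-* q p′))
      ; *-assoc = λ u v w → ≗⇒≈ℂ
          (λ n → solve 6 (λ a b c d e f →
              (a :* c :- b :* d) :* e :- (a :* d :+ b :* c) :* f :=
              a :* (c :* e :- d :* f) :- b :* (c :* f :+ d :* e)) refl
            (seq (re u) n) (seq (im u) n) (seq (re v) n) (seq (im v) n) (seq (re w) n) (seq (im w) n))
          (λ n → solve 6 (λ a b c d e f →
              (a :* c :- b :* d) :* f :+ (a :* d :+ b :* c) :* e :=
              a :* (c :* f :+ d :* e) :+ b :* (c :* e :- d :* f)) refl
            (seq (re u) n) (seq (im u) n) (seq (re v) n) (seq (im v) n) (seq (re w) n) (seq (im w) n))
      ; *-identity =
          (λ z → ≗⇒≈ℂ
            (λ n → solve 2 (λ a b → con 1ℚ :* a :- con 0ℚ :* b := a) refl (seq (re z) n) (seq (im z) n))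
            (λ n → solve 2 (λ a b → con 1ℚ :* b :+ con 0ℚ :* a := b) refl (seq (re z) n) (seq (im z) n))) ,
          (λ z → ≗⇒≈ℂ
            (λ n → solve 2 (λ a b → a :* con 1ℚ :- b :* con 0ℚ := a) refl (seq (re z) n) (seq (im z) n))
            (λ n → solve 2 (λ a b → a :* con 0ℚ :+ b :* con 1ℚ := b) refl (seq (re z) n) (seq (im z) n)))
      ; distrib =
          (λ u v w → ≗⇒≈ℂ
            (λ n → solve 6 (λ a b c d e f →
                a :* (c :+ e) :- b :* (d :+ f) :=
                (a :* c :- b :* d) :+ (a :* e :- b :* f)) refl
              (seq (re u) n) (seq (im u) n) (seq (re v) n) (seq (im v) n) (seq (re w) n) (seq (im w) n))
            (λ n → solve 6 (λ a b c d e f →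
                a :* (d :+ f) :+ b :* (c :+ e) :=
                (a :* d :+ b :* c) :+ (a :* f :+ b :* e)) refl
              (seq (re u) n) (seq (im u) n) (seq (re v) n) (seq (im v) n) (seq (re w) n) (seq (im w) n))) ,
          (λ u v w → ≗⇒≈ℂ
            (λ n → solve 6 (λ a b c d e f →
                (c :+ e) :* a :- (d :+ f) :* b :=
                (c :* a :- d :* b) :+ (e :* a :- f :* b)) refl
              (seq (re u) n) (seq (im u) n) (seq (re v) n) (seq (im v) n) (seq (re w) n) (seq (im w) n))
            (λ n → solve 6 (λ a b c d e f →
                (c :+ e) :* b :+ (d :+ f) :* a :=
                (c :* b :+ d :* a) :+ (e :* b :+ f :* a)) refl
              (seq (re u) n) (seq (im u) n) (seq (re v) n) (seq (im v) n) (seq (re w) n) (seq (im w) n)))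
      }
    ; *-comm = λ z w → ≗⇒≈ℂ
        (λ n → solve 4 (λ a b c d → a :* c :- b :* d := c :* a :- d :* b) refl
          (seq (re z) n) (seq (im z) n) (seq (re w) n) (seq (im w) n))
        (λ n → solve 4 (λ a b c d → a :* d :+ b :* c := c :* b :+ d :* a) refl
          (seq (re z) n) (seq (im z) n) (seq (re w) n) (seq (im w) n))
    }

ℂ-commutativeRing : CommutativeRing 0ℓ 0ℓ
ℂ-commutativeRing = record { isCommutativeRing = isCommutativeRing }

normSq : ℂ → ℝ
normSq z = re z *ℝ re z +ℝ im z *ℝ im z

private
  0≤∣p∣*∣p∣ : ∀ p → 0ℚ ≤ ∣ p ∣ * ∣ p ∣
  0≤∣p∣*∣p∣ p = subst (0ℚ ≤_) (∣p*q∣≡∣p∣*∣q∣ p p) (0≤∣p∣ (p * p))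

  0≤p*p : ∀ p → 0ℚ ≤ p * p
  0≤p*p p with ∣p∣≡p∨∣p∣≡-p p
  ... | inj₁ e = subst (0ℚ ≤_) (cong₂ _*_ e e) (0≤∣p∣*∣p∣ p)
  ... | inj₂ e = subst (0ℚ ≤_)
    (trans (cong₂ _*_ e e) (solve 1 (λ p → (:- p) :* (:- p) := p :* p) refl p))
    (0≤∣p∣*∣p∣ p)

  ≤-normSq : ∀ {δ} p q → 0ℚ < δ → δ ≤ ∣ p ∣ → δ * δ ≤ ∣ p * p + q * q ∣
  ≤-normSq {δ} p q 0<δ δ≤∣p∣ = begin
    δ * δ              ≤⟨ *-mono-≤ (0≤∣p∣ p) (<⇒≤ 0<δ) δ≤∣p∣ δ≤∣p∣ ⟩
    ∣ p ∣ * ∣ p ∣      ≡⟨ ∣p*q∣≡∣p∣*∣q∣ p p ⟨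
    ∣ p * p ∣          ≡⟨ 0≤p⇒∣p∣≡p (0≤p*p p) ⟩
    p * p              ≡⟨ +-identityʳ (p * p) ⟨
    p * p + 0ℚ         ≤⟨ +-monoʳ-≤ (p * p) (0≤p*p q) ⟩
    p * p + q * q      ≡⟨ 0≤p⇒∣p∣≡p (+-mono-≤ (0≤p*p p) (0≤p*p q)) ⟨
    ∣ p * p + q * q ∣  ∎
    where open ≤-Reasoning

normSq-#0 : ∀ z → z #0 → normSq z #0ℝ
normSq-#0 z (inj₁ (δ , N , 0<δ , away)) = δ * δ , N , 0<* 0<δ 0<δ , λ n N≤n →
  ≤-normSq (seq (re z) n) (seq (im z) n) 0<δ (away n N≤n)
normSq-#0 z (inj₂ (δ , N , 0<δ , away)) = δ * δ , N , 0<* 0<δ 0<δ , λ n N≤n →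
  subst (λ p → δ * δ ≤ ∣ p ∣)
    (+-comm (seq (im z) n * seq (im z) n) (seq (re z) n * seq (re z) n))
    (≤-normSq (seq (im z) n) (seq (re z) n) 0<δ (away n N≤n))

recipℂ : (z : ℂ) → z #0 → ℂ
recipℂ z z#0 = (re z *ℝ d) +i (-ℝ im z *ℝ d)
  where
  d : ℝ
  d = recipℝ (normSq z) (normSq-#0 z z#0)

recipℂ-inverseʳ : ∀ z (z#0 : z #0) → z *ℂ recipℂ z z#0 ≈ℂ 1ℂ
recipℂ-inverseʳ z z#0 = let δ , N , 0<δ , away = normSq-#0 z z#0 in mk≈
  (eventually≡⇒close N
    (λ n N≤n → trans
      (solve 3 (λ a b d → a :* (a :* d) :- b :* ((:- b) :* d) := (a :* a :+ b :* b) :* d) refl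
        (seq (re z) n) (seq (im z) n) (recip (seq (normSq z) n)))
      (recip-inverseʳ (seq (normSq z) n) 0<δ (away n N≤n)))
    (cauchy (fromℚ 1ℚ)))
  (eventually≡⇒close N
    (λ n _ → solve 3 (λ a b d → a :* ((:- b) :* d) :+ b :* (a :* d) := con 0ℚ) refl
        (seq (re z) n) (seq (im z) n) (recip (seq (normSq z) n)))
    (cauchy (fromℚ 0ℚ)))

module ℂ-Ring = CommutativeRing ℂ-commutativeRing

open import Algebra.Properties.Semiring.Exp ℂ-Ring.semiring public using (_^_)
open import Algebra.Properties.Monoid.Sum ℂ-Ring.+-monoid using (sum)

zpow : (z : ℂ) (k : ℤ) → (k ℤ.< 0ℤ → z #0) → ℂ
zpow z (ℤ.+ n)    _   = z ^ n
zpow z -[1+ n ] z#0 = recipℂ z (z#0 ℤ.-<+) ^ suc n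

chebyshevℕ : (y a b : ℂ) → ℕ → ℂ
chebyshevℕ y a b zero          = a
chebyshevℕ y a b (suc zero)    = b
chebyshevℕ y a b (suc (suc n)) =
  (1ℂ +ℂ 1ℂ) *ℂ y *ℂ chebyshevℕ y a b (suc n) ℂ-Ring.- chebyshevℕ y a b n

-- The solution on all of ℤ of S n = 2 y S (n - 1) - S (n - 2) with S 0 = a
-- and S 1 = b.  The recurrence is symmetric under n ↦ - n, so the values at
-- negative indices are obtained by running it from S 0 = a and
-- S (-1) = 2 y a - b.
chebyshev : (y a b : ℂ) → ℤ → ℂ
chebyshev y a b (ℤ.+ n)    = chebyshevℕ y a b n
chebyshev y a b -[1+ n ] = chebyshevℕ y a ((1ℂ +ℂ 1ℂ) *ℂ y *ℂ a ℂ-Ring.- b) (suc n)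

T U : ℤ → ℂ → ℂ
T n y = chebyshev y 1ℂ y n
U n y = chebyshev y 1ℂ ((1ℂ +ℂ 1ℂ) *ℂ y) n

-- The range c ≤ k ≤ n is enumerated as k = c + j with 0 ≤ j ≤ n - c.
sumFromTo : (c n : ℤ) → c ℤ.≤ n → (∀ k → c ℤ.≤ k → ℂ) → ℂ
sumFromTo c n _ f = sum {suc ℤ.∣ n ℤ.- c ∣} λ j →
  f (c ℤ.+ ℤ.+ toℕ j) (ℤ.i≤i+j c (ℤ.+ toℕ j))

{-# OPTIONS --safe #-}
-- Put V k = x^k y S(k-1).  Each summand is r^(n-k) (V (k+1) - r V k), so the
-- sum telescopes, as soon as the last factor of the summand is
-- x y S k - r y S (k-1).  For S = U this is T k = U k - y U (k-1), and for
-- S = T it is T k = y T (k-1) + (y² - 1) U (k-2).  In both identities the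
-- right-hand side solves the three-term recurrence on ℤ, so it is enough to
-- compare the values at 0 and 1.
module Submission where

open import Algebra.Bundles using (CommutativeRing)
open import Data.Integer.Base as ℤ using (ℤ; -[1+_]; 0ℤ; 1ℤ; ∣_∣)
open import Data.Integer.Properties using (≤-refl; ≤-trans; ≤-<-trans; i≤i+j)
open import Data.Product.Base using (_×_; _,_; proj₁; proj₂)

import Algebra.Properties.Monoid.Sum
import Algebra.Properties.Semiring.Exp
import Algebra.Solver.Ring
open import Algebra.Solver.Ring.AlmostCommutativeRing
  using (fromCommutativeRing; _-Raw-AlmostCommutative⟶_)
open import Data.Fin.Base as Fin using (Fin; toℕ)
open import Data.Fin.Properties using (toℕ≤pred[n])
import Data.Integer.Properties as ℤ
open import Data.Integer.Tactic.RingSolver using (solve-∀)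
open import Data.Maybe.Base using (Maybe; just; nothing)
open import Data.Nat.Base as ℕ using (ℕ; zero; suc)
import Data.Nat.Properties as ℕ
open import Data.Rational.Base as ℚ using (ℚ; 0ℚ; 1ℚ)
import Data.Rational.Properties as ℚ
open import Level using (_⊔_)
open import Relation.Binary.PropositionalEquality as ≡ using (_≡_; refl; cong; cong₂)
import Relation.Binary.Reasoning.Setoid
open import Relation.Nullary using (yes; no)

-- Arithmetic of the integer indices and of the exponents of `r`.

private
  n-[c+j] : ∀ n c j → n ℤ.- (c ℤ.+ j) ≡ (n ℤ.- c) ℤ.+ ℤ.- j
  n-[c+j] = solve-∀

  c+[n-c] : ∀ c n → c ℤ.+ (n ℤ.- c) ≡ n
  c+[n-c] = solve-∀

  c+[1+j] : ∀ c j → c ℤ.+ (1ℤ ℤ.+ j) ≡ 1ℤ ℤ.+ (c ℤ.+ j)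
  c+[1+j] = solve-∀

  k-2 : ∀ k → k ℤ.- ℤ.+ 2 ≡ ℤ.- 1ℤ ℤ.+ (ℤ.- 1ℤ ℤ.+ k)
  k-2 = solve-∀

pred[c+[1+j]] : ∀ c j → ℤ.pred (c ℤ.+ ℤ.+ suc j) ≡ c ℤ.+ ℤ.+ j
pred[c+[1+j]] c j = ≡.trans (cong ℤ.pred (c+[1+j] c (ℤ.+ j))) (ℤ.pred-suc (c ℤ.+ ℤ.+ j))

+∣n-c∣≡n-c : ∀ {c n} → c ℤ.≤ n → ℤ.+ ∣ n ℤ.- c ∣ ≡ n ℤ.- c
+∣n-c∣≡n-c c≤n = ℤ.0≤i⇒+∣i∣≡i (ℤ.i≤j⇒0≤j-i c≤n)

-- Puts the exponent of `r` in the summand at `k = c + j` into the form `d ∸ j` used for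
-- telescoping; the bound on `j` keeps the subtraction from being truncated.
∣n-[c+j]∣ : ∀ {c n j} → c ℤ.≤ n → j ℕ.≤ ∣ n ℤ.- c ∣ →
  ∣ n ℤ.- (c ℤ.+ ℤ.+ j) ∣ ≡ ∣ n ℤ.- c ∣ ℕ.∸ j
∣n-[c+j]∣ {c} {n} {j} c≤n j≤∣n-c∣ = cong ∣_∣ (begin
  n ℤ.- (c ℤ.+ ℤ.+ j)                ≡⟨ n-[c+j] n c (ℤ.+ j) ⟩
  (n ℤ.- c) ℤ.+ ℤ.- (ℤ.+ j)          ≡⟨ cong (ℤ._+ ℤ.- (ℤ.+ j)) (+∣n-c∣≡n-c c≤n) ⟨
  ℤ.+ ∣ n ℤ.- c ∣ ℤ.+ ℤ.- (ℤ.+ j)    ≡⟨ ℤ.m-n≡m⊖n ∣ n ℤ.- c ∣ j ⟩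
  ∣ n ℤ.- c ∣ ℤ.⊖ j                  ≡⟨ ℤ.⊖-≥ j≤∣n-c∣ ⟩
  ℤ.+ (∣ n ℤ.- c ∣ ℕ.∸ j)            ∎)
  where open ≡.≡-Reasoning

∣n-c+1∣ : ∀ {c n} → c ℤ.≤ n → ∣ n ℤ.- c ℤ.+ 1ℤ ∣ ≡ suc ∣ n ℤ.- c ∣
∣n-c+1∣ {c} {n} c≤n = ≡.trans
  (cong (λ i → ∣ i ℤ.+ 1ℤ ∣) (≡.sym (+∣n-c∣≡n-c c≤n)))
  (ℕ.+-comm ∣ n ℤ.- c ∣ 1)

c+∣n-c∣ : ∀ {c n} → c ℤ.≤ n → c ℤ.+ ℤ.+ ∣ n ℤ.- c ∣ ≡ n
c+∣n-c∣ {c} {n} c≤n = ≡.trans (cong (λ i → c ℤ.+ i) (+∣n-c∣≡n-c c≤n)) (c+[n-c] c n)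

-- The index one past the end of the range, at which the upper boundary term takes its power of `x`.
c+[1+∣n-c∣] : ∀ {c n} → c ℤ.≤ n → c ℤ.+ ℤ.+ suc ∣ n ℤ.- c ∣ ≡ n ℤ.+ 1ℤ
c+[1+∣n-c∣] {c} {n} c≤n = begin
  c ℤ.+ (1ℤ ℤ.+ ℤ.+ ∣ n ℤ.- c ∣)    ≡⟨ c+[1+j] c (ℤ.+ ∣ n ℤ.- c ∣) ⟩
  1ℤ ℤ.+ (c ℤ.+ ℤ.+ ∣ n ℤ.- c ∣)    ≡⟨ cong ℤ.suc (c+∣n-c∣ c≤n) ⟩
  1ℤ ℤ.+ n                          ≡⟨ ℤ.+-comm 1ℤ n ⟩
  n ℤ.+ 1ℤ                          ∎
  where open ≡.≡-Reasoning

-- An arbitrary ring is used because comparing two nested expressions over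
-- the concrete ℂ unfolds the arithmetic of Cauchy sequences and does not
-- finish.  The ring solver cancels only if it can decide that a coefficient
-- is 0, hence the homomorphism from ℚ.
module ℚ-Algebra {a ℓ} (R : CommutativeRing a ℓ)
  (ℚ⟶R : ℚ.+-*-rawRing -Raw-AlmostCommutative⟶ fromCommutativeRing R) where

  private module R = CommutativeRing R
  open R hiding (refl; zero)
  open Algebra.Properties.Monoid.Sum +-monoid using (sum)
  open Algebra.Properties.Semiring.Exp semiring using (_^_)
  open Relation.Binary.Reasoning.Setoid setoid
  open _-Raw-AlmostCommutative⟶_ ℚ⟶R using (⟦_⟧)

  private
    _≟_ : ∀ p q → Maybe (⟦ p ⟧ ≈ ⟦ q ⟧)
    p ≟ q with p ℚ.≟ q
    ... | yes p≡q = just (reflexive (cong ⟦_⟧ p≡q))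
    ... | no _    = nothing

  open Algebra.Solver.Ring ℚ.+-*-rawRing (fromCommutativeRing R) ℚ⟶R _≟_
    using (solve; _:=_; _:+_; _:*_; _:-_; :-_)

  private
    -‿cong₂ : ∀ {u u′ v v′} → u ≈ u′ → v ≈ v′ → u - v ≈ u′ - v′
    -‿cong₂ p q = +-cong p (-‿cong q)

  -- Telescoping sums.

  sum-telescope : ∀ m (t : Fin m → Carrier) (g : ℕ → Carrier) →
    (∀ j → t j ≈ g (suc (toℕ j)) - g (toℕ j)) → sum t ≈ g m - g 0
  sum-telescope zero    t g t≈ = sym (-‿inverseʳ (g 0))
  sum-telescope (suc m) t g t≈ = begin
    t Fin.zero + sum (λ j → t (Fin.suc j))
      ≈⟨ +-cong (t≈ Fin.zero)
           (sum-telescope m (λ j → t (Fin.suc j)) (λ j → g (suc j)) (λ j → t≈ (Fin.suc j))) ⟩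
    (g 1 - g 0) + (g (suc m) - g 1)
      ≈⟨ solve 3 (λ a b c → (b :- a) :+ (c :- b) := c :- a) R.refl (g 0) (g 1) (g (suc m)) ⟩
    g (suc m) - g 0
      ∎

  -- Solutions of the three-term recurrence on the integers.

  subtract-twice : ∀ u v → v ≈ u - (u - v)
  subtract-twice = solve 2 (λ u v → v := u :- (u :- v)) R.refl

  Recurrent : Carrier → (ℤ → Carrier) → Set ℓ
  Recurrent y S = ∀ k → S (ℤ.suc k) ≈ (1# + 1#) * y * S k - S (ℤ.pred k)

  -- The recurrence solved for its lowest term, which lets inductions run towards negative indices.
  recurrent-reflect : ∀ {y S} → Recurrent y S → ∀ k →
    S (ℤ.pred k) ≈ (1# + 1#) * y * S k - S (ℤ.suc k)
  recurrent-reflect {y} {S} rec k = trans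
    (subtract-twice ((1# + 1#) * y * S k) (S (ℤ.pred k)))
    (-‿cong₂ R.refl (sym (rec k)))

  -- Two adjacent values determine a solution in both directions, so each induction carries a pair
  -- of adjacent equalities: upwards by the recurrence, downwards by its reflected form.
  recurrent-unique : ∀ {y R S} → Recurrent y R → Recurrent y S →
    R 0ℤ ≈ S 0ℤ → R 1ℤ ≈ S 1ℤ → ∀ k → R k ≈ S k
  recurrent-unique {y} {R} {S} recR recS R0≈S0 R1≈S1 = λ where
      (ℤ.+ n)    → proj₁ (upwards n)
      -[1+ n ]   → proj₂ (downwards n)
    where
    upwards : ∀ n → R (ℤ.+ n) ≈ S (ℤ.+ n) × R (ℤ.+ suc n) ≈ S (ℤ.+ suc n)
    upwards zero    = R0≈S0 , R1≈S1
    upwards (suc n) = let p , q = upwards n in q , (begin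
      R (ℤ.+ suc (suc n))                                ≈⟨ recR (ℤ.+ suc n) ⟩
      (1# + 1#) * y * R (ℤ.+ suc n) - R (ℤ.+ n)          ≈⟨ -‿cong₂ (*-congˡ q) p ⟩
      (1# + 1#) * y * S (ℤ.+ suc n) - S (ℤ.+ n)          ≈⟨ recS (ℤ.+ suc n) ⟨
      S (ℤ.+ suc (suc n))                                ∎)

    down : ∀ k → R k ≈ S k → R (ℤ.suc k) ≈ S (ℤ.suc k) → R (ℤ.pred k) ≈ S (ℤ.pred k)
    down k p q = begin
      R (ℤ.pred k)                            ≈⟨ recurrent-reflect {S = R} recR k ⟩
      (1# + 1#) * y * R k - R (ℤ.suc k)       ≈⟨ -‿cong₂ (*-congˡ p) q ⟩
      (1# + 1#) * y * S k - S (ℤ.suc k)       ≈⟨ recurrent-reflect {S = S} recS k ⟨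
      S (ℤ.pred k)                            ∎

    downwards : ∀ n → R (ℤ.suc -[1+ n ]) ≈ S (ℤ.suc -[1+ n ]) × R -[1+ n ] ≈ S -[1+ n ]
    downwards zero    = R0≈S0 , down 0ℤ R0≈S0 R1≈S1
    downwards (suc n) = let p , q = downwards n in q , down -[1+ n ] q p

  -- This and the next two lemmas make the solutions a module closed under the shift, so that
  -- combinations of shifted `T` and `U` can be compared by `recurrent-unique`.
  recurrent-pred : ∀ {y S} → Recurrent y S → Recurrent y (λ k → S (ℤ.pred k))
  recurrent-pred {y} {S} rec k = begin
    S (ℤ.pred (ℤ.suc k))
      ≡⟨ cong S (≡.trans (ℤ.pred-suc k) (≡.sym (ℤ.suc-pred k))) ⟩
    S (ℤ.suc (ℤ.pred k))
      ≈⟨ rec (ℤ.pred k) ⟩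
    (1# + 1#) * y * S (ℤ.pred k) - S (ℤ.pred (ℤ.pred k))
      ∎

  recurrent-+ : ∀ {y R S} → Recurrent y R → Recurrent y S → Recurrent y (λ k → R k + S k)
  recurrent-+ {y} {R} {S} recR recS k = begin
    R (ℤ.suc k) + S (ℤ.suc k)
      ≈⟨ +-cong (recR k) (recS k) ⟩
    ((1# + 1#) * y * R k - R (ℤ.pred k)) + ((1# + 1#) * y * S k - S (ℤ.pred k))
      ≈⟨ solve 5 (λ 2y a b c d →
           (2y :* a :- b) :+ (2y :* c :- d) := 2y :* (a :+ c) :- (b :+ d)) R.refl
         ((1# + 1#) * y) (R k) (R (ℤ.pred k)) (S k) (S (ℤ.pred k)) ⟩
    (1# + 1#) * y * (R k + S k) - (R (ℤ.pred k) + S (ℤ.pred k))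
      ∎

  recurrent-* : ∀ {y S} p → Recurrent y S → Recurrent y (λ k → p * S k)
  recurrent-* {y} {S} p rec k = begin
    p * S (ℤ.suc k)
      ≈⟨ *-congˡ (rec k) ⟩
    p * ((1# + 1#) * y * S k - S (ℤ.pred k))
      ≈⟨ solve 4 (λ p 2y a b → p :* (2y :* a :- b) := 2y :* (p :* a) :- p :* b) R.refl
         p ((1# + 1#) * y) (S k) (S (ℤ.pred k)) ⟩
    (1# + 1#) * y * (p * S k) - p * S (ℤ.pred k)
      ∎

  2y≈y+y : ∀ y → (1# + 1#) * y ≈ y + y
  2y≈y+y y = trans (distribʳ y 1# 1#) (+-cong (*-identityˡ y) (*-identityˡ y))

  -- The weighted sum common to both identities.

  weighted-telescope : ∀ {x y r c d n e} {X : ℕ → Carrier} {A B} {P S : ℤ → Carrier}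
    (t : Fin (suc d) → Carrier) →
    (∀ j → X (suc j) ≈ x * X j) → X (suc d) ≈ A → X 0 ≈ B →
    c ℤ.+ ℤ.+ d ≡ n → e ≡ suc d →
    (∀ k → P k ≈ x * y * S k - r * y * S (ℤ.pred k)) →
    (∀ j → t j ≡ r ^ (d ℕ.∸ toℕ j) * X (toℕ j) * P (c ℤ.+ ℤ.+ toℕ j)) →
    sum t ≈ A * y * S n - r ^ e * B * y * S (c ℤ.- 1ℤ)
  weighted-telescope {x} {y} {r} {c} {d} {X = X} {A} {B} {P} {S} t X-suc XA XB refl refl P≈ t≡ = begin
    sum t
      ≈⟨ sum-telescope (suc d) t g step ⟩
    g (suc d) - g 0
      ≈⟨ -‿cong₂
           (*-cong
             (*-congʳ (trans (*-cong (reflexive (cong (r ^_) (ℕ.n∸n≡0 d))) XA) (*-identityˡ A)))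
             (reflexive (cong S (pred[c+[1+j]] c d))))
           (*-cong (*-congʳ (*-congˡ XB))
             (reflexive (cong S (≡.trans
               (cong ℤ.pred (ℤ.+-identityʳ c)) (ℤ.+-comm (ℤ.- 1ℤ) c))))) ⟩
    A * y * S (c ℤ.+ ℤ.+ d) - r ^ suc d * B * y * S (c ℤ.- 1ℤ)
      ∎
    where
    -- `X j` stands for `x` to the power `c + j`. The exponent `suc d ∸ j` is 0 at the upper end
    -- `j = suc d` and `suc d` at the lower end `j = 0`, as in the two boundary terms.
    g : ℕ → Carrier
    g j = r ^ (suc d ℕ.∸ j) * X j * y * S (ℤ.pred (c ℤ.+ ℤ.+ j))

    step : ∀ j → t j ≈ g (suc (toℕ j)) - g (toℕ j)
    step j = begin
      t j
        ≡⟨ t≡ j ⟩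
      r ^ e * X i * P k
        ≈⟨ *-congˡ (P≈ k) ⟩
      r ^ e * X i * (x * y * S k - r * y * S (ℤ.pred k))
        ≈⟨ solve 7 (λ x y r p z s s′ →
             p :* z :* (x :* y :* s :- r :* y :* s′) :=
             p :* (x :* z) :* y :* s :- (r :* p) :* z :* y :* s′) R.refl
           x y r (r ^ e) (X i) (S k) (S (ℤ.pred k)) ⟩
      r ^ e * (x * X i) * y * S k - r ^ suc e * X i * y * S (ℤ.pred k)
        ≈⟨ -‿cong₂
             (*-cong (*-congʳ (*-congˡ (sym (X-suc i))))
               (reflexive (cong S (≡.sym (pred[c+[1+j]] c i)))))
             -- `suc (d ∸ i)` equals `suc d ∸ i` because `i ≤ d`, as `j` ranges over `Fin (suc d)`.
             (*-congʳ (*-congʳ (*-congʳ (reflexive (cong (r ^_)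
               (≡.sym (ℕ.+-∸-assoc 1 (toℕ≤pred[n] j)))))))) ⟩
      g (suc i) - g i
        ∎
      where
      i e : ℕ
      i = toℕ j
      e = d ℕ.∸ i

      k : ℤ
      k = c ℤ.+ ℤ.+ i

  -- Chebyshev polynomials over a commutative ring.

  record IsChebyshev (y : Carrier) (T U : ℤ → Carrier) : Set ℓ where
    field
      T-recurrent : Recurrent y T
      T0≈1        : T 0ℤ ≈ 1#
      T1≈y        : T 1ℤ ≈ y
      U-recurrent : Recurrent y U
      U0≈1        : U 0ℤ ≈ 1#
      U1≈2y       : U 1ℤ ≈ (1# + 1#) * y

  module Chebyshev {y : Carrier} {T U : ℤ → Carrier} (isChebyshev : IsChebyshev y T U) where
    open IsChebyshev isChebyshev

    T₋₁≈y : T (ℤ.- 1ℤ) ≈ y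
    T₋₁≈y = begin
      T (ℤ.- 1ℤ)                     ≈⟨ recurrent-reflect {S = T} T-recurrent 0ℤ ⟩
      (1# + 1#) * y * T 0ℤ - T 1ℤ    ≈⟨ -‿cong₂ (*-cong (2y≈y+y y) T0≈1) T1≈y ⟩
      (y + y) * 1# - y               ≈⟨ +-congʳ (*-identityʳ (y + y)) ⟩
      (y + y) - y                    ≈⟨ solve 1 (λ y → (y :+ y) :- y := y) R.refl y ⟩
      y                              ∎

    U₋₁≈0 : U (ℤ.- 1ℤ) ≈ 0#
    U₋₁≈0 = begin
      U (ℤ.- 1ℤ)                           ≈⟨ recurrent-reflect {S = U} U-recurrent 0ℤ ⟩
      (1# + 1#) * y * U 0ℤ - U 1ℤ          ≈⟨ -‿cong₂ (*-congˡ U0≈1) U1≈2y ⟩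
      (1# + 1#) * y * 1# - (1# + 1#) * y   ≈⟨ +-congʳ (*-identityʳ ((1# + 1#) * y)) ⟩
      (1# + 1#) * y - (1# + 1#) * y        ≈⟨ -‿inverseʳ ((1# + 1#) * y) ⟩
      0#                                   ∎

    U₋₂≈-1 : U (ℤ.- (ℤ.+ 2)) ≈ - 1#
    U₋₂≈-1 = begin
      U (ℤ.- (ℤ.+ 2))                       ≈⟨ recurrent-reflect {S = U} U-recurrent (ℤ.- 1ℤ) ⟩
      (1# + 1#) * y * U (ℤ.- 1ℤ) - U 0ℤ     ≈⟨ -‿cong₂ (*-congˡ U₋₁≈0) U0≈1 ⟩
      (1# + 1#) * y * 0# - 1#               ≈⟨ +-congʳ (zeroʳ ((1# + 1#) * y)) ⟩
      0# - 1#                               ≈⟨ +-identityˡ (- 1#) ⟩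
      - 1#                                  ∎

    -- The difference is written as a sum with coefficient `- y` so that the closure lemmas apply.
    -- At 1 the claim is `y = 2y - y`.
    T≈U-yU : ∀ k → T k ≈ U k + - y * U (ℤ.pred k)
    T≈U-yU = recurrent-unique T-recurrent
      (recurrent-+ {R = U} U-recurrent
        (recurrent-* {S = λ k → U (ℤ.pred k)} (- y) (recurrent-pred {S = U} U-recurrent)))
      (begin
        T 0ℤ                         ≈⟨ T0≈1 ⟩
        1#                           ≈⟨ +-identityʳ 1# ⟨
        1# + 0#                      ≈⟨ +-congˡ (zeroʳ (- y)) ⟨
        1# + - y * 0#                ≈⟨ +-cong U0≈1 (*-congˡ U₋₁≈0) ⟨
        U 0ℤ + - y * U (ℤ.- 1ℤ)      ∎)
      (begin
        T 1ℤ                         ≈⟨ T1≈y ⟩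
        y                            ≈⟨ solve 1 (λ y → y := (y :+ y) :+ :- y) R.refl y ⟩
        (y + y) + - y                ≈⟨ +-cong (2y≈y+y y) (*-identityʳ (- y)) ⟨
        (1# + 1#) * y + - y * 1#     ≈⟨ +-cong U1≈2y (*-congˡ U0≈1) ⟨
        U 1ℤ + - y * U 0ℤ            ∎)

    T≈yT+[y²-1]U : ∀ k → T k ≈ y * T (ℤ.pred k) + (y ^ 2 - 1#) * U (ℤ.pred (ℤ.pred k))
    T≈yT+[y²-1]U = recurrent-unique T-recurrent
      (recurrent-+ {R = λ k → y * T (ℤ.pred k)}
        (recurrent-* {S = λ k → T (ℤ.pred k)} y (recurrent-pred {S = T} T-recurrent))
        (recurrent-* {S = λ k → U (ℤ.pred (ℤ.pred k))} (y ^ 2 - 1#)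
          (recurrent-pred {S = λ k → U (ℤ.pred k)} (recurrent-pred {S = U} U-recurrent))))
      (begin
        T 0ℤ                                             ≈⟨ T0≈1 ⟩
        -- With `T (-1) = y` and `U (-2) = -1`, the claim at 0 is `1 = y² - (y² - 1)`. The power
        -- `y ^ 2` unfolds to `y * (y * 1#)`.
        1#                                               ≈⟨ subtract-twice (y * y) 1# ⟩
        y * y - (y * y - 1#)
          ≈⟨ -‿cong₂ R.refl (+-congʳ (*-congˡ (*-identityʳ y))) ⟨
        y * y - (y ^ 2 - 1#)
          ≈⟨ -‿cong₂ R.refl (*-identityʳ (y ^ 2 - 1#)) ⟨
        y * y - (y ^ 2 - 1#) * 1#
          ≈⟨ solve 3 (λ v w o → v :+ w :* (:- o) := v :- w :* o) R.refl (y * y) (y ^ 2 - 1#) 1# ⟨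
        y * y + (y ^ 2 - 1#) * - 1#
          ≈⟨ +-cong (*-congˡ T₋₁≈y) (*-congˡ U₋₂≈-1) ⟨
        y * T (ℤ.- 1ℤ) + (y ^ 2 - 1#) * U (ℤ.- (ℤ.+ 2))  ∎)
      (begin
        T 1ℤ                                             ≈⟨ T1≈y ⟩
        y                                                ≈⟨ *-identityʳ y ⟨
        y * 1#                                           ≈⟨ +-identityʳ (y * 1#) ⟨
        y * 1# + 0#                                      ≈⟨ +-congˡ (zeroʳ (y ^ 2 - 1#)) ⟨
        y * 1# + (y ^ 2 - 1#) * 0#
          ≈⟨ +-cong (*-congˡ T0≈1) (*-congˡ U₋₁≈0) ⟨
        y * T 0ℤ + (y ^ 2 - 1#) * U (ℤ.- 1ℤ)             ∎)

    U-summand : ∀ x r k → r * T k + (x * y - r) * U k ≈ x * y * U k - r * y * U (ℤ.pred k)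
    U-summand x r k = begin
      r * T k + (x * y - r) * U k
        ≈⟨ +-congʳ (*-congˡ (T≈U-yU k)) ⟩
      r * (U k + - y * U (ℤ.pred k)) + (x * y - r) * U k
        ≈⟨ solve 5 (λ x y r u u′ →
             r :* (u :+ (:- y) :* u′) :+ (x :* y :- r) :* u :=
             x :* y :* u :- r :* y :* u′) R.refl
           x y r (U k) (U (ℤ.pred k)) ⟩
      x * y * U k - r * y * U (ℤ.pred k)
        ∎

    T-summand : ∀ x r k →
      (y ^ 2 - 1#) * r * U (k ℤ.- ℤ.+ 2) + (x * y - r) * T k ≈ x * y * T k - r * y * T (ℤ.pred k)
    T-summand x r k = begin
      w * r * U (k ℤ.- ℤ.+ 2) + (x * y - r) * T k
        ≡⟨ cong (λ l → w * r * U l + (x * y - r) * T k) (k-2 k) ⟩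
      w * r * u + (x * y - r) * T k
        ≈⟨ +-congˡ (*-congˡ (T≈yT+[y²-1]U k)) ⟩
      w * r * u + (x * y - r) * (y * t + w * u)
        -- `w` stays an indeterminate: `w * r * u` cancels against the term `- r * (w * u)` of the
        -- product.
        ≈⟨ solve 6 (λ x y r w u t →
             w :* r :* u :+ (x :* y :- r) :* (y :* t :+ w :* u) :=
             x :* y :* (y :* t :+ w :* u) :- r :* y :* t) R.refl
           x y r w u t ⟩
      x * y * (y * t + w * u) - r * y * t
        ≈⟨ -‿cong₂ (*-congˡ (T≈yT+[y²-1]U k)) R.refl ⟨
      x * y * T k - r * y * t
        ∎
      where
      w u t : Carrier
      w = y ^ 2 - 1#
      u = U (ℤ.pred (ℤ.pred k))
      t = T (ℤ.pred k)

  -- The two-sided recurrence for sequences computed separately in each direction.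

  private
    variable
      _+′_ _*′_ _-′_ : Carrier → Carrier → Carrier
      1′             : Carrier
      _^′_           : Carrier → ℕ → Carrier

  -- For the instantiation at ℂ, the operations in which the objects of Defs
  -- and the theorem are written are passed as variables, so that each of
  -- them is compared with the corresponding operation of R on its own.
  chebyshev-isChebyshev : _+′_ ≡ _+_ → _*′_ ≡ _*_ → _-′_ ≡ _-_ → 1′ ≡ 1# →
    (F : Carrier → Carrier → Carrier → ℕ → Carrier)
    (G : Carrier → Carrier → Carrier → ℤ → Carrier) →
    (∀ y a b → F y a b 0 ≡ a) →
    (∀ y a b → F y a b 1 ≡ b) →
    (∀ y a b n → F y a b (suc (suc n)) ≡
      ((((1′ +′ 1′) *′ y) *′ F y a b (suc n)) -′ F y a b n)) →
    (∀ y a b n → G y a b (ℤ.+ n) ≡ F y a b n) →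
    (∀ y a b n → G y a b -[1+ n ] ≡ F y a ((((1′ +′ 1′) *′ y) *′ a) -′ b) (suc n)) →
    ∀ y → IsChebyshev y (G y 1′ y) (G y 1′ ((1′ +′ 1′) *′ y))
  chebyshev-isChebyshev refl refl refl refl F G F-0 F-1 F-suc G-+ G-- y = record
    { T-recurrent = G-recurrent 1# y
    ; T0≈1        = reflexive (G-0 1# y)
    ; T1≈y        = reflexive (G-1 1# y)
    ; U-recurrent = G-recurrent 1# ((1# + 1#) * y)
    ; U0≈1        = reflexive (G-0 1# ((1# + 1#) * y))
    ; U1≈2y       = reflexive (G-1 1# ((1# + 1#) * y))
    }
    where
    G-0 : ∀ a b → G y a b 0ℤ ≡ a
    G-0 a b = ≡.trans (G-+ y a b 0) (F-0 y a b)

    G-1 : ∀ a b → G y a b 1ℤ ≡ b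
    G-1 a b = ≡.trans (G-+ y a b 1) (F-1 y a b)

    -- Extends the clause for `-[1+ n ]` to index 0, where the upward and the downward run share the
    -- value `a`.
    G-neg : ∀ a b n → G y a b (ℤ.- (ℤ.+ n)) ≡ F y a ((1# + 1#) * y * a - b) n
    G-neg a b zero    = ≡.trans (G-0 a b) (≡.sym (F-0 y a ((1# + 1#) * y * a - b)))
    G-neg a b (suc n) = G-- y a b n

    -- The recurrence read downwards is again the recurrence of F.
    backwards : ∀ a b k {u v w} → G y a b k ≡ v → G y a b (ℤ.suc k) ≡ u → G y a b (ℤ.pred k) ≡ w →
      w ≡ (1# + 1#) * y * v - u →
      G y a b (ℤ.suc k) ≈ (1# + 1#) * y * G y a b k - G y a b (ℤ.pred k)
    backwards a b k refl refl refl w≡ =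
      trans (subtract-twice ((1# + 1#) * y * G y a b k) (G y a b (ℤ.suc k)))
        (-‿cong₂ R.refl (reflexive (≡.sym w≡)))

    G-recurrent : ∀ a b → Recurrent y (G y a b)
    -- The runs meet here: the value at -1 was chosen as `2ya - b`, which is the recurrence at 0.
    G-recurrent a b (ℤ.+ zero) = backwards a b 0ℤ (G-0 a b) (G-1 a b) (G-neg a b 1)
      (F-1 y a ((1# + 1#) * y * a - b))
    G-recurrent a b (ℤ.+ suc n) = reflexive (≡.trans (G-+ y a b (suc (suc n)))
      (≡.trans (F-suc y a b n)
        (≡.sym (cong₂ (λ v w → (1# + 1#) * y * v - w) (G-+ y a b (suc n)) (G-+ y a b n)))))
    G-recurrent a b -[1+ zero ] = backwards a b -[1+ 0 ]
      (G-neg a b 1) (G-neg a b 0) (G-neg a b 2) (F-suc y a ((1# + 1#) * y * a - b) 0)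
    G-recurrent a b -[1+ suc n ] = backwards a b -[1+ suc n ]
      (G-neg a b (suc (suc n))) (G-neg a b (suc n)) (G-neg a b (suc (suc (suc n))))
      (F-suc y a ((1# + 1#) * y * a - b) (suc n))

  -- Integer powers.

  record IsZPower {p} {P : Set p} (x : Carrier) (z : (k : ℤ) → (k ℤ.< 0ℤ → P) → Carrier) :
    Set (p ⊔ ℓ) where
    field
      zpow-cong : ∀ {k l} p q → k ≡ l → z k p ≈ z l q
      zpow-suc  : ∀ k p q → z (ℤ.suc k) q ≈ x * z k p

  -- Used to replace the base of a negative power by the reciprocal obtained from another proof of
  -- invertibility.
  ^-congˡ : ∀ {u v} n → u ≈ v → u ^ n ≈ v ^ n
  ^-congˡ zero    u≈v = R.refl
  ^-congˡ (suc n) u≈v = *-cong u≈v (^-congˡ n u≈v)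

  inverse-cancelˡ : ∀ u v w → u * v ≈ 1# → u * (v * w) ≈ w
  inverse-cancelˡ u v w uv≈1 = begin
    u * (v * w)    ≈⟨ *-assoc u v w ⟨
    u * v * w      ≈⟨ *-congʳ uv≈1 ⟩
    1# * w         ≈⟨ *-identityˡ w ⟩
    w              ∎

  -- Makes negative powers independent, up to `≈`, of the proof of invertibility; each summand
  -- carries its own such proof.
  inverse-unique : ∀ u v w → u * v ≈ 1# → u * w ≈ 1# → v ≈ w
  inverse-unique u v w uv≈1 uw≈1 = begin
    v              ≈⟨ inverse-cancelˡ u w v uw≈1 ⟨
    u * (w * v)    ≈⟨ *-congˡ (*-comm w v) ⟩
    u * (v * w)    ≈⟨ inverse-cancelˡ u v w uv≈1 ⟩
    w              ∎

  isZPower : _^′_ ≡ _^_ → ∀ {p} {P : Set p} x (v : P → Carrier) → (∀ a → x * v a ≈ 1#) →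
    (z : (k : ℤ) → (k ℤ.< 0ℤ → P) → Carrier) →
    (∀ n p → z (ℤ.+ n) p ≡ (x ^′ n)) →
    (∀ n p → z -[1+ n ] p ≡ (v (p ℤ.-<+) ^′ suc n)) →
    IsZPower x z
  isZPower refl x v xv≈1 z z-+ z-- = record { zpow-cong = zpow-cong ; zpow-suc = zpow-suc }
    where
    v-irrelevant : ∀ a b → v a ≈ v b
    v-irrelevant a b = inverse-unique x (v a) (v b) (xv≈1 a) (xv≈1 b)

    zpow-cong : ∀ {k l} p q → k ≡ l → z k p ≈ z l q
    zpow-cong {ℤ.+ n} p q refl = reflexive (≡.trans (z-+ n p) (≡.sym (z-+ n q)))
    zpow-cong { -[1+ n ]} p q refl = begin
      z -[1+ n ] p            ≡⟨ z-- n p ⟩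
      v (p ℤ.-<+) ^ suc n     ≈⟨ ^-congˡ (suc n) (v-irrelevant (p ℤ.-<+) (q ℤ.-<+)) ⟩
      v (q ℤ.-<+) ^ suc n     ≡⟨ z-- n q ⟨
      z -[1+ n ] q            ∎

    zpow-suc : ∀ k p q → z (ℤ.suc k) q ≈ x * z k p
    zpow-suc (ℤ.+ n) p q =
      reflexive (≡.trans (z-+ (suc n) q) (cong (x *_) (≡.sym (z-+ n p))))
    zpow-suc -[1+ zero ] p q = begin
      z 0ℤ q                      ≡⟨ z-+ 0 q ⟩
      1#                          ≈⟨ inverse-cancelˡ x (v (p ℤ.-<+)) 1# (xv≈1 (p ℤ.-<+)) ⟨
      x * (v (p ℤ.-<+) * 1#)      ≡⟨ cong (x *_) (z-- 0 p) ⟨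
      x * z -[1+ 0 ] p            ∎
    zpow-suc -[1+ suc n ] p q = begin
      z -[1+ n ] q                      ≡⟨ z-- n q ⟩
      -- The powers at `k + 1` and at `k` carry different proofs, which must be matched before `x`
      -- cancels one reciprocal.
      v (q ℤ.-<+) ^ suc n               ≈⟨ ^-congˡ (suc n) (v-irrelevant (q ℤ.-<+) (p ℤ.-<+)) ⟩
      v (p ℤ.-<+) ^ suc n               ≈⟨ inverse-cancelˡ x (v (p ℤ.-<+)) _ (xv≈1 (p ℤ.-<+)) ⟨
      x * v (p ℤ.-<+) ^ suc (suc n)     ≡⟨ cong (x *_) (z-- (suc n) p) ⟨
      x * z -[1+ suc n ] p              ∎

  -- The two identities over a commutative ring.

  identities : ∀ {_≈′_ : Carrier → Carrier → Set ℓ} →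
    _≈′_ ≡ _≈_ → _+′_ ≡ _+_ → _*′_ ≡ _*_ → _-′_ ≡ _-_ → 1′ ≡ 1# → _^′_ ≡ _^_ →
    (sumFromTo : (c n : ℤ) → c ℤ.≤ n → (∀ k → c ℤ.≤ k → Carrier) → Carrier) →
    (∀ c n c≤n f → sumFromTo c n c≤n f ≡
      sum {suc ∣ n ℤ.- c ∣} (λ j → f (c ℤ.+ ℤ.+ toℕ j) (i≤i+j c (ℤ.+ toℕ j)))) →
    ∀ {p} {P : Set p} {x y r z T U} → IsZPower {P = P} x z → IsChebyshev y T U →
    ∀ c n (c≤n : c ℤ.≤ n) (x#0 : c ℤ.< 0ℤ → P) →
    let x^ : (k : ℤ) → c ℤ.≤ k → Carrier
        x^ k c≤k = z k (λ k<0 → x#0 (≤-<-trans c≤k k<0))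
        c≤n+1 = ≤-trans c≤n (i≤i+j n 1ℤ)
    in
    (sumFromTo c n c≤n (λ k c≤k →
        ((r ^′ ∣ n ℤ.- k ∣) *′ x^ k c≤k) *′ ((r *′ T k) +′ (((x *′ y) -′ r) *′ U k)))
      ≈′ (((x^ (n ℤ.+ 1ℤ) c≤n+1 *′ y) *′ U n)
        -′ ((((r ^′ ∣ n ℤ.- c ℤ.+ 1ℤ ∣) *′ x^ c ≤-refl) *′ y) *′ U (c ℤ.- 1ℤ))))
    ×
    (sumFromTo c n c≤n (λ k c≤k →
        ((r ^′ ∣ n ℤ.- k ∣) *′ x^ k c≤k) *′
          (((((y ^′ 2) -′ 1′) *′ r) *′ U (k ℤ.- ℤ.+ 2)) +′ (((x *′ y) -′ r) *′ T k)))
      ≈′ (((x^ (n ℤ.+ 1ℤ) c≤n+1 *′ y) *′ T n)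
        -′ ((((r ^′ ∣ n ℤ.- c ℤ.+ 1ℤ ∣) *′ x^ c ≤-refl) *′ y) *′ T (c ℤ.- 1ℤ))))
  identities refl refl refl refl refl refl sumFromTo sumFromTo≡
    {P = P} {x} {y} {r} {z} {T} {U} isZPower isChebyshev c n c≤n x#0 =
    telescope (λ k → r * T k + (x * y - r) * U k) U (U-summand x r) ,
    telescope (λ k → (y ^ 2 - 1#) * r * U (k ℤ.- ℤ.+ 2) + (x * y - r) * T k) T (T-summand x r)
    where
    open IsZPower isZPower
    open Chebyshev isChebyshev

    x^ : (k : ℤ) → c ℤ.≤ k → Carrier
    x^ k c≤k = z k (λ k<0 → x#0 (≤-<-trans c≤k k<0))

    index : ℕ → ℤ
    index j = c ℤ.+ ℤ.+ j

    x^c+ : ℕ → Carrier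
    x^c+ j = x^ (index j) (i≤i+j c (ℤ.+ j))

    x^c+-suc : ∀ j → x^c+ (suc j) ≈ x * x^c+ j
    x^c+-suc j = trans
      -- The index `c + (1 + j)` is first rewritten as `1 + (c + j)`; its bound by `c` from below
      -- supplies invertibility of `x` if it is negative.
      (zpow-cong _ (λ k<0 → x#0 (≤-<-trans c≤1+index k<0)) (c+[1+j] c (ℤ.+ j)))
      (zpow-suc (index j) _ _)
      where
      c≤1+index : c ℤ.≤ ℤ.suc (index j)
      c≤1+index = ≤-trans (i≤i+j c (ℤ.+ j)) (ℤ.i≤suc[i] (index j))

    telescope : (P S : ℤ → Carrier) →
      (∀ k → P k ≈ x * y * S k - r * y * S (ℤ.pred k)) →
      sumFromTo c n c≤n (λ k c≤k → r ^ ∣ n ℤ.- k ∣ * x^ k c≤k * P k)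
        ≈ x^ (n ℤ.+ 1ℤ) (≤-trans c≤n (i≤i+j n 1ℤ)) * y * S n
          - r ^ ∣ n ℤ.- c ℤ.+ 1ℤ ∣ * x^ c ≤-refl * y * S (c ℤ.- 1ℤ)
    telescope P S P≈ = trans
      (reflexive (sumFromTo≡ c n c≤n (λ k c≤k → r ^ ∣ n ℤ.- k ∣ * x^ k c≤k * P k)))
      (weighted-telescope {c = c} {X = x^c+} {P = P} {S = S} _
        x^c+-suc
        (zpow-cong _ _ (c+[1+∣n-c∣] c≤n))
        (zpow-cong _ _ (ℤ.+-identityʳ c))
        (c+∣n-c∣ c≤n)
        (∣n-c+1∣ c≤n)
        P≈
        (λ j → cong (λ e → r ^ e * x^c+ (toℕ j) * P (index (toℕ j)))
          (∣n-[c+j]∣ c≤n (toℕ≤pred[n] j))))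

-- Specialization to the complex numbers.

open import Defs
open CommutativeRing ℂ-commutativeRing using (_≈_; _+_; _*_; _-_; 1#)

private
  const-close : ∀ {p q} → p ≡ q → Close (λ _ → p) (λ _ → q)
  const-close {p} refl = cauchy (fromℚ p)

ℚ⟶ℂ : ℚ.+-*-rawRing -Raw-AlmostCommutative⟶ fromCommutativeRing ℂ-commutativeRing
ℚ⟶ℂ = record
  { ⟦_⟧    = λ q → fromℚ q +i fromℚ 0ℚ
  ; +-homo = λ p q → mk≈ (const-close {p ℚ.+ q} refl) (const-close {0ℚ} refl)
  -- The product of `p + 0i` and `q + 0i` leaves the terms `- 0 * 0` in the real part and
  -- `p * 0 + 0 * q` in the imaginary part, which have to be removed.
  ; *-homo = λ p q → mk≈
      (const-close {p ℚ.* q} {p ℚ.* q ℚ.+ ℚ.- (0ℚ ℚ.* 0ℚ)} (≡.sym (ℚ.+-identityʳ (p ℚ.* q))))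
      (const-close {0ℚ} {p ℚ.* 0ℚ ℚ.+ 0ℚ ℚ.* q}
        (≡.sym (cong₂ ℚ._+_ (ℚ.*-zeroʳ p) (ℚ.*-zeroˡ q))))
  ; -‿homo = λ p → mk≈ (const-close {ℚ.- p} refl) (const-close {0ℚ} refl)
  ; 0-homo = ℂ-Ring.refl {0ℂ}
  ; 1-homo = ℂ-Ring.refl {1ℂ}
  }

open ℚ-Algebra ℂ-commutativeRing ℚ⟶ℂ

ℂ-isChebyshev : ∀ y → IsChebyshev y (λ k → T k y) (λ k → U k y)
ℂ-isChebyshev = chebyshev-isChebyshev
  {_+ℂ_} {_*ℂ_} {ℂ-Ring._-_} {1ℂ} refl refl refl refl chebyshevℕ chebyshev
  (λ _ _ _ → refl) (λ _ _ _ → refl) (λ _ _ _ _ → refl) (λ _ _ _ _ → refl) (λ _ _ _ _ → refl)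

ℂ-isZPower : ∀ x → IsZPower x (zpow x)
ℂ-isZPower x = isZPower {_^_} refl x (recipℂ x) (recipℂ-inverseʳ x) (zpow x)
  (λ _ _ → refl) (λ _ _ → refl)

-- The operations of the theorem are abbreviations for projections of
-- ℂ-commutativeRing.  Agda expands them when they are given as arguments, but
-- not when they are read off the type of an equation.
private
  ≈-≡ : _≈_ ≡ CommutativeRing._≈_ ℂ-commutativeRing
  ≈-≡ = refl

  +-≡ : _+_ ≡ CommutativeRing._+_ ℂ-commutativeRing
  +-≡ = refl

  *-≡ : _*_ ≡ CommutativeRing._*_ ℂ-commutativeRing
  *-≡ = refl

  minus-≡ : _-_ ≡ CommutativeRing._-_ ℂ-commutativeRing
  minus-≡ = refl

  1#-≡ : 1# ≡ CommutativeRing.1# ℂ-commutativeRing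
  1#-≡ = refl

  ^-≡ : _^_ ≡ Algebra.Properties.Semiring.Exp._^_ (CommutativeRing.semiring ℂ-commutativeRing)
  ^-≡ = refl

theorem11 :
  (x y r : ℂ) (c n : ℤ) (c≤n : c ℤ.≤ n) (x#0 : c ℤ.< 0ℤ → x #0) →
  let x^ : (k : ℤ) → c ℤ.≤ k → ℂ
      x^ k c≤k = zpow x k (λ k<0 → x#0 (≤-<-trans c≤k k<0))
      c≤n+1 = ≤-trans c≤n (i≤i+j n 1ℤ)
  in
  (sumFromTo c n c≤n (λ k c≤k →
      r ^ ∣ n ℤ.- k ∣ * x^ k c≤k * (r * T k y + (x * y - r) * U k y))
    ≈ x^ (n ℤ.+ 1ℤ) c≤n+1 * y * U n y
      - r ^ ∣ n ℤ.- c ℤ.+ 1ℤ ∣ * x^ c ≤-refl * y * U (c ℤ.- 1ℤ) y)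
  ×
  (sumFromTo c n c≤n (λ k c≤k →
      r ^ ∣ n ℤ.- k ∣ * x^ k c≤k *
        ((y ^ 2 - 1#) * r * U (k ℤ.- ℤ.+ 2) y + (x * y - r) * T k y))
    ≈ x^ (n ℤ.+ 1ℤ) c≤n+1 * y * T n y
      - r ^ ∣ n ℤ.- c ℤ.+ 1ℤ ∣ * x^ c ≤-refl * y * T (c ℤ.- 1ℤ) y)
theorem11 x y r c n c≤n x#0 = identities ≈-≡ +-≡ *-≡ minus-≡ 1#-≡ ^-≡
  sumFromTo (λ _ _ _ _ → refl) {P = x #0} {x} {y} {r} {zpow x} {λ k → T k y} {λ k → U k y}
  (ℂ-isZPower x) (ℂ-isChebyshev y) c n c≤n x#0
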